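{- Let $q$ be a prime power, $q-1=ds$ with $d,s$ positive integers, let $r_0,\dots,r_{d-1}$ be positive integers, let $a_0,\dots,a_{d-1}\in\mathbb{F}_q^*$, let $\xi$ be a primitive element of $\mathbb{F}_q$ and $\omega=\xi^s$. Let $$f(x)=\frac{1}{d}\sum_{i=0}^{d-1}\sum_{j=0}^{d-1} a_i\,\omega^{ -ij}\,x^{r_i+js}\in\mathbb{F}_q[x].$$ If $f$ is a permutation polynomial of $\mathbb{F}_q$, then its inverse over $\mathbb{F}_q$ is given by $$f^{ -1}(x)=\frac{1}{d}\sum_{i=0}^{d-1}\sum_{j=0}^{d-1}\omega^{i(t_i-jr_i)}\left(\frac{x}{a_i}\right)^{\tilde r_i+js},$$ where $\tilde r_i,t_i\in\mathbb{Z}$ satisfy $1\le \tilde r_i<s$ and $r_i\tilde r_i+st_i=1$ (for each $i=0,\dots,d-1$).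
   Context: A polynomial $f\in\mathbb{F}_q[x]$ is a permutation polynomial of $\mathbb{F}_q$ if it induces a bijection of $\mathbb{F}_q$. A polynomial $g$ is the inverse of $f$ over $\mathbb{F}_q$ if $g(f(c))=c$ for all $c\in\mathbb{F}_q$ (equivalently $g(f(x))\equiv x\pmod{x^q-x}$). Since $d\mid q-1$, $d$ is invertible in $\mathbb{F}_q$, so $1/d$ makes sense. (The polynomial $f$ is the cyclotomic mapping with $f(0)=0$ and $f(x)=a_ix^{r_i}$ for $x\in\xi^i\langle\xi^d\rangle$.) -}

module Defs where

open import Algebra.Bundles using (CommutativeRing; RawSemiring; Semiring)
import Algebra.Definitions
import Algebra.Definitions.RawSemiring
open import Data.Fin.Base using (Fin)
import Data.Fin.Properties as Finₚ
open import Data.Integer.Base using (ℤ; +_; -[1+_])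
open import Data.List.Base using (List; []; _∷_; map; foldr)
open import Data.Nat.Base as ℕ using (ℕ; zero; suc)
open import Data.Nat.Primality using (Prime)
open import Data.Product.Base using (∃; ∃₂; _×_; _,_; proj₁)
open import Function.Bundles using (Inverse)
open import Function.Definitions using (Bijective)
open import Function.Properties.Inverse using (Inverse⇒Injection)
open import Level using (Level; _⊔_)
open import Relation.Binary.Definitions using (Decidable)
open import Relation.Binary.PropositionalEquality.Core using (_≡_)
import Relation.Binary.PropositionalEquality.Properties as ≡
open import Relation.Nullary.Decidable.Core using (yes; no)
open import Relation.Nullary.Negation.Core using (¬_)

IsPrimePower : ℕ → Set
IsPrimePower q = ∃₂ λ p m → Prime p × 0 ℕ.< m × q ≡ p ℕ.^ m

-- A field with exactly q elements, counted up to its setoid equality.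
record FiniteField (c ℓ : Level) (q : ℕ) : Set (Level.suc (c ⊔ ℓ)) where
  field
    commutativeRing : CommutativeRing c ℓ

  open CommutativeRing commutativeRing public
  open Algebra.Definitions _≈_ public using (Invertible)

  field
    1≉0         : ¬ (1# ≈ 0#)
    invertible  : ∀ x → ¬ (x ≈ 0#) → Invertible 1# _*_ x
    enumeration : Inverse setoid (≡.setoid (Fin q))

  open Algebra.Definitions.RawSemiring (Semiring.rawSemiring semiring) public
    using (_^_) renaming (_×_ to _×ℕ_)

  infix 4 _≟_

  _≟_ : Decidable _≈_
  _≟_ = Finₚ.inj⇒≟ (Inverse⇒Injection enumeration)

  infix 9 _⁻¹

  -- Totalised by 0# ⁻¹ = 0#.
  _⁻¹ : Carrier → Carrier
  x ⁻¹ with x ≟ 0#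
  ... | yes _   = 0#
  ... | no  x≉0 = proj₁ (invertible x x≉0)

  infixr 8 _^ᶻ_

  _^ᶻ_ : Carrier → ℤ → Carrier
  x ^ᶻ (+ n)    = x ^ n
  x ^ᶻ -[1+ n ] = (x ⁻¹) ^ suc n

  IsPrimitive : Carrier → Set (c ⊔ ℓ)
  IsPrimitive ξ = ¬ (ξ ≈ 0#) × (∀ x → ¬ (x ≈ 0#) → ∃ λ n → x ≈ ξ ^ n)

module Polynomials {c ℓ : Level} {q : ℕ} (F : FiniteField c ℓ q) where
  open FiniteField F

  -- Coefficient lists, constant term first; trailing zeros are allowed, so
  -- polynomials are compared with _≈ᴾ_.
  Polynomial : Set c
  Polynomial = List Carrier

  coeff : Polynomial → ℕ → Carrier
  coeff []      _       = 0#
  coeff (a ∷ f) zero    = a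
  coeff (a ∷ f) (suc n) = coeff f n

  infix  4 _≈ᴾ_
  infixl 6 _+ᴾ_
  infixl 7 _*ᴾ_

  _≈ᴾ_ : Polynomial → Polynomial → Set ℓ
  f ≈ᴾ g = ∀ n → coeff f n ≈ coeff g n

  _+ᴾ_ : Polynomial → Polynomial → Polynomial
  []      +ᴾ g       = g
  (a ∷ f) +ᴾ []      = a ∷ f
  (a ∷ f) +ᴾ (b ∷ g) = (a + b) ∷ (f +ᴾ g)

  _*ᴾ_ : Polynomial → Polynomial → Polynomial
  []      *ᴾ g = []
  (a ∷ f) *ᴾ g = map (a *_) g +ᴾ (0# ∷ (f *ᴾ g))

  C : Carrier → Polynomial
  C a = a ∷ []

  X : Polynomial
  X = 0# ∷ 1# ∷ []

  polynomialRawSemiring : RawSemiring c ℓ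
  polynomialRawSemiring = record
    { Carrier = Polynomial
    ; _≈_     = _≈ᴾ_
    ; _+_     = _+ᴾ_
    ; _*_     = _*ᴾ_
    ; 0#      = []
    ; 1#      = C 1#
    }

  open Algebra.Definitions.RawSemiring polynomialRawSemiring public
    using () renaming (_^_ to _^ᴾ_; sum to ∑ᴾ)

  eval : Polynomial → Carrier → Carrier
  eval f x = foldr (λ a v → a + x * v) 0# f

  IsPermutationPolynomial : Polynomial → Set (c ⊔ ℓ)
  IsPermutationPolynomial f = Bijective _≈_ _≈_ (eval f)

  infix 4 _IsInverseOf_

  _IsInverseOf_ : Polynomial → Polynomial → Set (c ⊔ ℓ)
  g IsInverseOf f = ∀ x → eval g (eval f x) ≈ x

{-# OPTIONS --safe #-}

-- Put ω = ξ ^ s, an element of exact order d.  On nonzero x the sum over j is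
-- geometric, with ratio a d-th root of unity, so it is d or 0 and f x = a_k x^(r_k),
-- where k is the unique index with x ^ s = ω ^ k.  Likewise the i-th summand of
-- g y survives only if (y / a_i) ^ s = (ω ^ i) ^ (r_i); then Bézout's relation
-- makes z = (ω ^ i)^(t_i) (y / a_i)^(r̃_i) a solution of z ^ s = ω ^ i and
-- a_i z^(r_i) = y, i.e. f z = y.  If y = f x, injectivity of f gives z = x, so
-- that exactly the index i = k survives and contributes x.
module Submission where

open import Defs
open import Level using (Level)
open import Data.Fin.Base using (Fin; zero; suc; toℕ; fromℕ<)
import Data.Fin.Properties as Finₚ
open import Data.Fin.Permutation using (Permutation; permutation; _⟨$⟩ʳ_)
open import Data.Integer.Base as ℤ using (ℤ; +_; -[1+_]; 1ℤ)
import Data.Integer.Properties as ℤₚ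
open import Data.Integer.Tactic.RingSolver using (solve-∀)
open import Data.List.Base using ([]; _∷_; map)
open import Data.Nat.Base as ℕ using (ℕ; zero; suc; NonZero)
import Data.Nat.DivMod as ℕ
import Data.Nat.Properties as ℕ
open import Data.Product.Base using (∃; _×_; _,_; proj₁; proj₂)
open import Function.Base using (_∘_)
open import Function.Bundles using (Inverse)
open import Function.Definitions using (Injective)
open import Relation.Binary.Definitions using (tri<; tri≈; tri>)
open import Relation.Binary.PropositionalEquality.Core as ≡ using (_≡_; _≢_)
open import Relation.Nullary.Decidable.Core using (yes; no)
open import Relation.Nullary.Negation.Core using (¬_; contradiction)

module FieldProperties {c ℓ : Level} {q : ℕ} (F : FiniteField c ℓ q) where
  open FiniteField F hiding (zero)

  open import Algebra.Properties.Ring ring using (+-cancelˡ; +-cancelʳ; -‿distribˡ-*)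
  open import Algebra.Properties.AbelianGroup +-abelianGroup using (x∙y⁻¹≈ε⇒x≈y)
  open import Algebra.Properties.CommutativeSemigroup *-commutativeSemigroup
    using (interchange; x∙yz≈y∙xz)
  open import Algebra.Properties.Semiring.Exp semiring
    using (^-congˡ; ^-congʳ; ^-homo-*; ^-assocʳ)
  open import Algebra.Properties.CommutativeSemiring.Exp commutativeSemiring
    using (^-distrib-*)
  open import Algebra.Properties.Semiring.Mult semiring using (×1-homo-*)
  open import Algebra.Properties.CommutativeMonoid.Sum +-commutativeMonoid
    using (sum; sum-cong-≋; sum-replicate; sum-replicate-zero; sum-remove; ∑-distrib-+; sum-permute)
  open import Algebra.Properties.Semiring.Sum semiring using (*-distribˡ-sum)
  open import Relation.Binary.Reasoning.Setoid setoid

  -- Cancellation, inverses and natural powers in a finite field.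

  ≉-resp-≈ : ∀ {x y} → x ≈ y → x ≉ 0# → y ≉ 0#
  ≉-resp-≈ x≈y x≉0 y≈0 = x≉0 (trans x≈y y≈0)

  ⁻¹-inverseˡ : ∀ {x} → x ≉ 0# → x ⁻¹ * x ≈ 1#
  ⁻¹-inverseˡ {x} x≉0 with x ≟ 0#
  ... | yes x≈0  = contradiction x≈0 x≉0
  ... | no  x≉0′ = proj₁ (proj₂ (invertible x x≉0′))

  *-cancelˡ-≉0 : ∀ {x y z} → x ≉ 0# → x * y ≈ x * z → y ≈ z
  *-cancelˡ-≉0 {x} {y} {z} x≉0 xy≈xz = begin
    y              ≈⟨ expand y ⟩
    x ⁻¹ * (x * y) ≈⟨ *-congˡ xy≈xz ⟩
    x ⁻¹ * (x * z) ≈⟨ expand z ⟨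
    z              ∎
    where
    expand : ∀ u → u ≈ x ⁻¹ * (x * u)
    expand u = begin
      u              ≈⟨ *-identityˡ u ⟨
      1# * u         ≈⟨ *-congʳ (⁻¹-inverseˡ x≉0) ⟨
      x ⁻¹ * x * u   ≈⟨ *-assoc _ _ _ ⟩
      x ⁻¹ * (x * u) ∎

  x*y≈1⇒y≈x⁻¹ : ∀ {x y} → x ≉ 0# → x * y ≈ 1# → y ≈ x ⁻¹
  x*y≈1⇒y≈x⁻¹ x≉0 xy≈1 =
    *-cancelˡ-≉0 x≉0 (trans xy≈1 (sym (trans (*-comm _ _) (⁻¹-inverseˡ x≉0))))

  *-≉0 : ∀ {x y} → x ≉ 0# → y ≉ 0# → x * y ≉ 0#
  *-≉0 x≉0 y≉0 xy≈0 = y≉0 (*-cancelˡ-≉0 x≉0 (trans xy≈0 (sym (zeroʳ _))))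

  ⁻¹-≉0 : ∀ {x} → x ≉ 0# → x ⁻¹ ≉ 0#
  ⁻¹-≉0 x≉0 x⁻¹≈0 =
    1≉0 (trans (sym (⁻¹-inverseˡ x≉0)) (trans (*-congʳ x⁻¹≈0) (zeroˡ _)))

  -- `_⁻¹` picks a witness after deciding equality with zero, so congruence is not automatic; it
  -- comes from uniqueness of inverses.
  ⁻¹-cong : ∀ {x y} → x ≉ 0# → x ≈ y → x ⁻¹ ≈ y ⁻¹
  ⁻¹-cong x≉0 x≈y = x*y≈1⇒y≈x⁻¹ (≉-resp-≈ x≈y x≉0)
    (trans (*-congʳ (sym x≈y)) (trans (*-comm _ _) (⁻¹-inverseˡ x≉0)))

  ^-≉0 : ∀ {x} n → x ≉ 0# → x ^ n ≉ 0#
  ^-≉0 zero    x≉0 = 1≉0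
  ^-≉0 (suc n) x≉0 = *-≉0 x≉0 (^-≉0 n x≉0)

  ^-zeroˡ : ∀ {x n} → 0 ℕ.< n → x ≈ 0# → x ^ n ≈ 0#
  ^-zeroˡ {n = suc n} _ x≈0 = trans (*-congʳ x≈0) (zeroˡ _)

  1^n≈1 : ∀ n → 1# ^ n ≈ 1#
  1^n≈1 zero    = refl
  1^n≈1 (suc n) = trans (*-identityˡ _) (1^n≈1 n)

  ^-comm : ∀ x m n → (x ^ m) ^ n ≈ (x ^ n) ^ m
  ^-comm x m n = begin
    (x ^ m) ^ n   ≈⟨ ^-assocʳ x m n ⟩
    x ^ (m ℕ.* n) ≈⟨ ^-congʳ x (ℕ.*-comm m n) ⟩
    x ^ (n ℕ.* m) ≈⟨ ^-assocʳ x n m ⟨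
    (x ^ n) ^ m   ∎

  ^-inverse : ∀ {x} n → x ≉ 0# → (x ⁻¹) ^ n * x ^ n ≈ 1#
  ^-inverse {x} n x≉0 = begin
    (x ⁻¹) ^ n * x ^ n ≈⟨ ^-distrib-* (x ⁻¹) x n ⟨
    (x ⁻¹ * x) ^ n     ≈⟨ ^-congˡ n (⁻¹-inverseˡ x≉0) ⟩
    1# ^ n             ≈⟨ 1^n≈1 n ⟩
    1#                 ∎

  ⁻¹-^ : ∀ {x} n → x ≉ 0# → (x ⁻¹) ^ n ≈ (x ^ n) ⁻¹
  ⁻¹-^ n x≉0 = x*y≈1⇒y≈x⁻¹ (^-≉0 n x≉0) (trans (*-comm _ _) (^-inverse n x≉0))

  ^-cancelˡ : ∀ {x} → x ≉ 0# → ∀ {m n} → m ℕ.≤ n → x ^ m ≈ x ^ n → x ^ (n ℕ.∸ m) ≈ 1#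
  ^-cancelˡ {x} x≉0 {m} {n} m≤n xᵐ≈xⁿ = *-cancelˡ-≉0 (^-≉0 m x≉0) (begin
    x ^ m * x ^ (n ℕ.∸ m) ≈⟨ ^-homo-* x m (n ℕ.∸ m) ⟨
    x ^ (m ℕ.+ (n ℕ.∸ m)) ≈⟨ ^-congʳ x (ℕ.m+[n∸m]≡n m≤n) ⟩
    x ^ n                 ≈⟨ xᵐ≈xⁿ ⟨
    x ^ m                 ≈⟨ *-identityʳ _ ⟨
    x ^ m * 1#            ∎)

  ^-% : ∀ {x} m .{{_ : NonZero m}} → x ^ m ≈ 1# → ∀ n → x ^ n ≈ x ^ (n ℕ.% m)
  ^-% {x} m xᵐ≈1 n = begin
    x ^ n                                       ≈⟨ ^-congʳ x (ℕ.m≡m%n+[m/n]*n n m) ⟩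
    x ^ (n ℕ.% m ℕ.+ (n ℕ./ m) ℕ.* m)           ≈⟨ ^-homo-* x (n ℕ.% m) _ ⟩
    x ^ (n ℕ.% m) * x ^ ((n ℕ./ m) ℕ.* m)       ≈⟨ *-congˡ (^-assocʳ x (n ℕ./ m) m) ⟨
    x ^ (n ℕ.% m) * (x ^ (n ℕ./ m)) ^ m         ≈⟨ *-congˡ (^-comm x (n ℕ./ m) m) ⟩
    x ^ (n ℕ.% m) * (x ^ m) ^ (n ℕ./ m)         ≈⟨ *-congˡ (^-congˡ (n ℕ./ m) xᵐ≈1) ⟩
    x ^ (n ℕ.% m) * 1# ^ (n ℕ./ m)              ≈⟨ *-congˡ (1^n≈1 (n ℕ./ m)) ⟩
    x ^ (n ℕ.% m) * 1#                          ≈⟨ *-identityʳ _ ⟩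
    x ^ (n ℕ.% m)                               ∎

  -- Integer powers

  ^ᶻ-congʳ : ∀ x {i j} → i ≡ j → x ^ᶻ i ≈ x ^ᶻ j
  ^ᶻ-congʳ x ≡.refl = refl

  ^ᶻ-congˡ : ∀ {x y} i → x ≉ 0# → x ≈ y → x ^ᶻ i ≈ y ^ᶻ i
  ^ᶻ-congˡ (+ n)    x≉0 x≈y = ^-congˡ n x≈y
  ^ᶻ-congˡ -[1+ n ] x≉0 x≈y = ^-congˡ (suc n) (⁻¹-cong x≉0 x≈y)

  -- Negation of `+ n` computes only after splitting on `n`; afterwards both sides agree by
  -- definition.
  ^ᶻ-neg : ∀ x n → x ^ᶻ (ℤ.- + n) ≈ (x ⁻¹) ^ n
  ^ᶻ-neg x zero    = refl
  ^ᶻ-neg x (suc n) = refl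

  ^ᶻ-≉0 : ∀ {x} i → x ≉ 0# → x ^ᶻ i ≉ 0#
  ^ᶻ-≉0 (+ n)    x≉0 = ^-≉0 n x≉0
  ^ᶻ-≉0 -[1+ n ] x≉0 = ^-≉0 (suc n) (⁻¹-≉0 x≉0)

  -- Integer addition with mixed signs reduces to `ℤ.⊖`, so this is the mixed case of `^ᶻ-homo-*`.
  -- The recursion cancels one factor `x * x ⁻¹` at a time.
  ^ᶻ-⊖ : ∀ {x} m n → x ≉ 0# → x ^ᶻ (m ℤ.⊖ n) ≈ x ^ m * (x ⁻¹) ^ n
  ^ᶻ-⊖     zero    zero    x≉0 = sym (*-identityʳ _)
  ^ᶻ-⊖     zero    (suc n) x≉0 = sym (*-identityˡ _)
  ^ᶻ-⊖     (suc m) zero    x≉0 = sym (*-identityʳ _)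
  ^ᶻ-⊖ {x} (suc m) (suc n) x≉0 = begin
    x ^ᶻ (suc m ℤ.⊖ suc n)                ≈⟨ ^ᶻ-congʳ x (ℤₚ.[1+m]⊖[1+n]≡m⊖n m n) ⟩
    x ^ᶻ (m ℤ.⊖ n)                        ≈⟨ ^ᶻ-⊖ m n x≉0 ⟩
    x ^ m * (x ⁻¹) ^ n                    ≈⟨ *-identityˡ _ ⟨
    1# * (x ^ m * (x ⁻¹) ^ n)             ≈⟨ *-congʳ (trans (*-comm _ _) (⁻¹-inverseˡ x≉0)) ⟨
    (x * x ⁻¹) * (x ^ m * (x ⁻¹) ^ n)     ≈⟨ interchange _ _ _ _ ⟩
    (x * x ^ m) * (x ⁻¹ * (x ⁻¹) ^ n)     ∎

  ^ᶻ-homo-* : ∀ {x} i j → x ≉ 0# → x ^ᶻ (i ℤ.+ j) ≈ x ^ᶻ i * x ^ᶻ j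
  ^ᶻ-homo-* {x} (+ m)    (+ n)    x≉0 = ^-homo-* x m n
  ^ᶻ-homo-*     (+ m)    -[1+ n ] x≉0 = ^ᶻ-⊖ m (suc n) x≉0
  ^ᶻ-homo-*     -[1+ m ] (+ n)    x≉0 = trans (^ᶻ-⊖ n (suc m) x≉0) (*-comm _ _)
  ^ᶻ-homo-* {x} -[1+ m ] -[1+ n ] x≉0 = begin
    (x ⁻¹) ^ suc (suc (m ℕ.+ n))       ≈⟨ ^-congʳ (x ⁻¹) (≡.cong suc (ℕ.+-suc m n)) ⟨
    (x ⁻¹) ^ (suc m ℕ.+ suc n)         ≈⟨ ^-homo-* (x ⁻¹) (suc m) (suc n) ⟩
    (x ⁻¹) ^ suc m * (x ⁻¹) ^ suc n    ∎

  ^ᶻ-assocˡ : ∀ x n i → (x ^ᶻ i) ^ n ≈ x ^ᶻ (+ n ℤ.* i)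
  ^ᶻ-assocˡ x n (+ m) = begin
    (x ^ m) ^ n            ≈⟨ ^-assocʳ x m n ⟩
    x ^ (m ℕ.* n)          ≈⟨ ^-congʳ x (ℕ.*-comm m n) ⟩
    x ^ᶻ (+ (n ℕ.* m))     ≈⟨ ^ᶻ-congʳ x (ℤₚ.pos-* n m) ⟩
    x ^ᶻ (+ n ℤ.* + m)     ∎
  ^ᶻ-assocˡ x n -[1+ m ] = begin
    ((x ⁻¹) ^ suc m) ^ n          ≈⟨ ^-assocʳ (x ⁻¹) (suc m) n ⟩
    (x ⁻¹) ^ (suc m ℕ.* n)        ≈⟨ ^-congʳ (x ⁻¹) (ℕ.*-comm (suc m) n) ⟩
    (x ⁻¹) ^ (n ℕ.* suc m)        ≈⟨ ^ᶻ-neg x (n ℕ.* suc m) ⟨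
    x ^ᶻ (ℤ.- + (n ℕ.* suc m))    ≈⟨ ^ᶻ-congʳ x (≡.cong ℤ.-_ (ℤₚ.pos-* n (suc m))) ⟩
    x ^ᶻ (ℤ.- (+ n ℤ.* + suc m))  ≈⟨ ^ᶻ-congʳ x (ℤₚ.neg-distribʳ-* (+ n) (+ suc m)) ⟩
    x ^ᶻ (+ n ℤ.* -[1+ m ])       ∎

  ^ᶻ-^-comm : ∀ {x} n i → x ≉ 0# → (x ^ᶻ i) ^ n ≈ (x ^ n) ^ᶻ i
  ^ᶻ-^-comm {x} n (+ m)    x≉0 = ^-comm x m n
  ^ᶻ-^-comm {x} n -[1+ m ] x≉0 =
    trans (^-comm (x ⁻¹) (suc m) n) (^-congˡ (suc m) (⁻¹-^ n x≉0))

  -- The relation `w ^ s ≈ v ^ r` turns the s-th power of the product into v to the exponent rr̃ +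
  -- st, and its r-th power into w to the same exponent, which is 1.
  bezout : ∀ {v w} (r s r̃ : ℕ) (t : ℤ) →
           + r ℤ.* + r̃ ℤ.+ + s ℤ.* t ≡ 1ℤ → v ≉ 0# → w ≉ 0# → w ^ s ≈ v ^ r →
           (v ^ᶻ t * w ^ r̃) ^ s ≈ v × (v ^ᶻ t * w ^ r̃) ^ r ≈ w
  bezout {v} {w} r s r̃ t rr̃+st≡1 v≉0 w≉0 wˢ≈vʳ =
    (begin
      (v ^ᶻ t * w ^ r̃) ^ s                 ≈⟨ ^-distrib-* (v ^ᶻ t) (w ^ r̃) s ⟩
      (v ^ᶻ t) ^ s * (w ^ r̃) ^ s           ≈⟨ *-congˡ (^-comm w r̃ s) ⟩
      (v ^ᶻ t) ^ s * (w ^ s) ^ r̃           ≈⟨ *-cong (^ᶻ-assocˡ v s t) (^-congˡ r̃ wˢ≈vʳ) ⟩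
      v ^ᶻ (+ s ℤ.* t) * (v ^ r) ^ r̃       ≈⟨ recombine v≉0 ⟩
      v                                     ∎) ,
    (begin
      (v ^ᶻ t * w ^ r̃) ^ r                 ≈⟨ ^-distrib-* (v ^ᶻ t) (w ^ r̃) r ⟩
      (v ^ᶻ t) ^ r * (w ^ r̃) ^ r           ≈⟨ *-cong (^ᶻ-^-comm r t v≉0) (^-comm w r̃ r) ⟩
      -- Replacing `v ^ r` by `w ^ s` leaves powers of `w` alone.
      (v ^ r) ^ᶻ t * (w ^ r) ^ r̃           ≈⟨ *-congʳ (^ᶻ-congˡ t (^-≉0 s w≉0) wˢ≈vʳ) ⟨
      (w ^ s) ^ᶻ t * (w ^ r) ^ r̃           ≈⟨ *-congʳ (^ᶻ-^-comm s t w≉0) ⟨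
      (w ^ᶻ t) ^ s * (w ^ r) ^ r̃           ≈⟨ *-congʳ (^ᶻ-assocˡ w s t) ⟩
      w ^ᶻ (+ s ℤ.* t) * (w ^ r) ^ r̃       ≈⟨ recombine w≉0 ⟩
      w                                     ∎)
    where
    recombine : ∀ {u} → u ≉ 0# → u ^ᶻ (+ s ℤ.* t) * (u ^ r) ^ r̃ ≈ u
    recombine {u} u≉0 = begin
      u ^ᶻ (+ s ℤ.* t) * (u ^ r) ^ r̃          ≈⟨ *-comm _ _ ⟩
      (u ^ r) ^ r̃ * u ^ᶻ (+ s ℤ.* t)          ≈⟨ *-congʳ (^ᶻ-assocˡ u r̃ (+ r)) ⟩
      u ^ᶻ (+ r̃ ℤ.* + r) * u ^ᶻ (+ s ℤ.* t)   ≈⟨ *-congʳ (^ᶻ-congʳ u (ℤₚ.*-comm (+ r̃) (+ r))) ⟩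
      u ^ᶻ (+ r ℤ.* + r̃) * u ^ᶻ (+ s ℤ.* t)   ≈⟨ ^ᶻ-homo-* (+ r ℤ.* + r̃) (+ s ℤ.* t) u≉0 ⟨
      u ^ᶻ (+ r ℤ.* + r̃ ℤ.+ + s ℤ.* t)        ≈⟨ ^ᶻ-congʳ u rr̃+st≡1 ⟩
      u * 1#                                  ≈⟨ *-identityʳ u ⟩
      u                                       ∎

  -- Finite sums

  sum-zero : ∀ {n} {h : Fin n → Carrier} → (∀ i → h i ≈ 0#) → sum h ≈ 0#
  sum-zero {n} h≈0 = trans (sum-cong-≋ h≈0) (sum-replicate-zero n)

  sum-single : ∀ {n} (h : Fin n → Carrier) k → (∀ i → i ≢ k → h i ≈ 0#) → sum h ≈ h k
  sum-single {suc n} h k h≈0 = begin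
    sum h    ≈⟨ sum-remove {i = k} h ⟩
    h k + _  ≈⟨ +-congˡ (sum-zero (λ j → h≈0 _ (Finₚ.punchInᵢ≢i k j))) ⟩
    h k + 0# ≈⟨ +-identityʳ _ ⟩
    h k      ∎

  geometric : ℕ → Carrier → Carrier
  geometric n u = sum {n} (λ j → u ^ toℕ j)

  geometric-suc : ∀ n u → geometric (suc n) u ≈ 1# + u * geometric n u
  geometric-suc n u = +-congˡ (sym (*-distribˡ-sum {n} u (λ j → u ^ toℕ j)))

  -- This is (u - 1)(1 + u + ... + u^(n-1)) = u^n - 1 with the negative terms moved across, so that
  -- the induction uses semiring laws only.
  geometric-telescope : ∀ n u → u * geometric n u + 1# ≈ geometric n u + u ^ n
  geometric-telescope zero    u = +-congʳ (zeroʳ u)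
  geometric-telescope (suc n) u = begin
    u * geometric (suc n) u + 1#           ≈⟨ +-comm _ _ ⟩
    1# + u * geometric (suc n) u           ≈⟨ +-congˡ (*-congˡ (geometric-suc n u)) ⟩
    1# + u * (1# + u * geometric n u)      ≈⟨ +-congˡ (*-congˡ (+-comm _ _)) ⟩
    1# + u * (u * geometric n u + 1#)      ≈⟨ +-congˡ (*-congˡ (geometric-telescope n u)) ⟩
    1# + u * (geometric n u + u ^ n)       ≈⟨ +-congˡ (distribˡ u _ _) ⟩
    1# + (u * geometric n u + u ^ suc n)   ≈⟨ +-assoc _ _ _ ⟨
    1# + u * geometric n u + u ^ suc n     ≈⟨ +-congʳ (geometric-suc n u) ⟨
    geometric (suc n) u + u ^ suc n        ∎

  geometric-unit : ∀ n {u} → u ≈ 1# → geometric n u ≈ n ×ℕ 1#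
  geometric-unit n u≈1 = trans
    (sum-cong-≋ {n} (λ j → trans (^-congˡ (toℕ j) u≈1) (1^n≈1 (toℕ j))))
    (sum-replicate n)

  -- Telescoping gives (u - 1) times the sum equal to u^n - 1 = 0, and the nonzero factor u - 1
  -- cancels.
  geometric-root : ∀ n {u} → u ^ n ≈ 1# → u ≉ 1# → geometric n u ≈ 0#
  geometric-root n {u} uⁿ≈1 u≉1 =
    *-cancelˡ-≉0 (u≉1 ∘ x∙y⁻¹≈ε⇒x≈y u 1#) (begin
      (u + - 1#) * g          ≈⟨ distribʳ g u (- 1#) ⟩
      u * g + - 1# * g        ≈⟨ +-cong ug≈g (trans (sym (-‿distribˡ-* 1# g)) (-‿cong (*-identityˡ g))) ⟩
      g + - g                 ≈⟨ -‿inverseʳ g ⟩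
      0#                      ≈⟨ zeroʳ _ ⟨
      (u + - 1#) * 0#         ∎)
    where
    g = geometric n u
    ug≈g : u * g ≈ g
    ug≈g = +-cancelʳ 1# _ _ (trans (geometric-telescope n u) (+-congˡ uⁿ≈1))

  -- The inner sum is `e i` times a geometric sum, which is d when `u i` is 1 and vanishes at every
  -- other d-th root of unity. In this form it evaluates both `f` and its inverse.
  orthogonality : ∀ {d} → d ×ℕ 1# ≉ 0# → (e u : Fin d → Carrier) (k : Fin d) →
                  (∀ i → u i ^ d ≈ 1#) → u k ≈ 1# → (∀ i → i ≢ k → u i ≉ 1#) →
                  (d ×ℕ 1#) ⁻¹ * sum (λ i → sum {d} (λ j → e i * u i ^ toℕ j)) ≈ e k
  orthogonality {d} d≉0 e u k uᵈ≈1 uₖ≈1 u≉1 = begin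
    (d ×ℕ 1#) ⁻¹ * sum (λ i → sum {d} (λ j → e i * u i ^ toℕ j))
      ≈⟨ *-congˡ (sum-cong-≋ λ i → sym (*-distribˡ-sum {d} (e i) (λ j → u i ^ toℕ j))) ⟩
    (d ×ℕ 1#) ⁻¹ * sum (λ i → e i * geometric d (u i))
      ≈⟨ *-congˡ (sum-single (λ i → e i * geometric d (u i)) k λ i i≢k →
           trans (*-congˡ (geometric-root d (uᵈ≈1 i) (u≉1 i i≢k))) (zeroʳ _)) ⟩
    (d ×ℕ 1#) ⁻¹ * (e k * geometric d (u k))
      ≈⟨ *-congˡ (*-congˡ (geometric-unit d uₖ≈1)) ⟩
    (d ×ℕ 1#) ⁻¹ * (e k * (d ×ℕ 1#))   ≈⟨ x∙yz≈y∙xz _ _ _ ⟩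
    e k * ((d ×ℕ 1#) ⁻¹ * (d ×ℕ 1#))   ≈⟨ *-congˡ (⁻¹-inverseˡ d≉0) ⟩
    e k * 1#                           ≈⟨ *-identityʳ _ ⟩
    e k                                ∎

  -- Characteristic and order

  open Inverse enumeration using (to; from; to-cong; strictlyInverseˡ; strictlyInverseʳ)

  to-injective : ∀ {x y} → to x ≡ to y → x ≈ y
  to-injective {x} {y} eq = begin
    x           ≈⟨ strictlyInverseʳ x ⟨
    from (to x) ≡⟨ ≡.cong from eq ⟩
    from (to y) ≈⟨ strictlyInverseʳ y ⟩
    y           ∎

  from-injective : Injective _≡_ _≈_ from
  from-injective {i} {j} eq =
    ≡.trans (≡.sym (strictlyInverseˡ i)) (≡.trans (to-cong eq) (strictlyInverseˡ j))

  -- Adding 1 is transported to the indices in `Fin q`, where sums can be reindexed.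
  translation : Permutation q q
  translation = permutation (λ i → to (from i + 1#)) (λ i → to (from i + - 1#))
    (λ i → undo i (- 1#) 1# (-‿inverseˡ 1#)) (λ i → undo i 1# (- 1#) (-‿inverseʳ 1#))
    where
    undo : ∀ i x y → x + y ≈ 0# → to (from (to (from i + x)) + y) ≡ i
    undo i x y x+y≈0 = ≡.trans (to-cong (begin
      from (to (from i + x)) + y ≈⟨ +-congʳ (strictlyInverseʳ _) ⟩
      from i + x + y             ≈⟨ +-assoc _ _ _ ⟩
      from i + (x + y)           ≈⟨ +-congˡ x+y≈0 ⟩
      from i + 0#                ≈⟨ +-identityʳ _ ⟩
      from i                     ∎)) (strictlyInverseˡ i)

  -- The sum of all elements is invariant under translation by 1.
  q×1≈0 : q ×ℕ 1# ≈ 0#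
  q×1≈0 = +-cancelˡ (sum from) _ _ (begin
    sum from + q ×ℕ 1#                    ≈⟨ +-congˡ (sum-replicate q) ⟨
    sum from + sum {q} (λ _ → 1#)         ≈⟨ ∑-distrib-+ from (λ _ → 1#) ⟨
    sum (λ i → from i + 1#)               ≈⟨ sum-cong-≋ (λ i → strictlyInverseʳ (from i + 1#)) ⟨
    sum (λ i → from (translation ⟨$⟩ʳ i)) ≈⟨ sum-permute from translation ⟨
    sum from                              ≈⟨ +-identityʳ _ ⟨
    sum from + 0#                         ∎)

  q∸1≡m⇒q≡1+m : ∀ {m} → q ℕ.∸ 1 ≡ m → q ≡ suc m
  q∸1≡m⇒q≡1+m eq =
    -- The index `to 0#` lies in `Fin q`, so q is positive and the truncated subtraction loses
    -- nothing.
    ≡.trans (≡.sym (ℕ.m+[n∸m]≡n (ℕ.≤-<-trans ℕ.z≤n (Finₚ.toℕ<n (to 0#))))) (≡.cong suc eq)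

  -- Since q = 1 + ds, the vanishing of d in the field would make q equal to 1 there, whereas it is
  -- 0.
  d∣q-1⇒d×1≉0 : ∀ {d s} → q ℕ.∸ 1 ≡ d ℕ.* s → d ×ℕ 1# ≉ 0#
  d∣q-1⇒d×1≉0 {d} {s} q-1≡ds d×1≈0 = 1≉0 (begin
    1#                              ≈⟨ +-identityʳ _ ⟨
    1# + 0#                         ≈⟨ +-congˡ (zeroˡ _) ⟨
    1# + 0# * (s ×ℕ 1#)             ≈⟨ +-congˡ (*-congʳ d×1≈0) ⟨
    1# + (d ×ℕ 1#) * (s ×ℕ 1#)      ≈⟨ +-congˡ (×1-homo-* d s) ⟨
    suc (d ℕ.* s) ×ℕ 1#             ≡⟨ ≡.cong (_×ℕ 1#) (q∸1≡m⇒q≡1+m q-1≡ds) ⟨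
    q ×ℕ 1#                         ≈⟨ q×1≈0 ⟩
    0#                              ∎)

  -- A list of candidates for the field elements: 0 followed by the first n powers of ξ. It is
  -- compared with the q actual elements, once to bound q above and once to force a repetition.
  zeroOrPower : ∀ {n} → Carrier → Fin (suc n) → Carrier
  zeroOrPower ξ zero    = 0#
  zeroOrPower ξ (suc i) = ξ ^ toℕ i

  -- Exponents of ξ may be reduced modulo m, so 0 and the m powers below ξ^m exhaust the field; q
  -- elements then inject into m + 1 candidates.
  primitive-order-≥ : ∀ {ξ} → IsPrimitive ξ → ∀ {m} → 0 ℕ.< m → ξ ^ m ≈ 1# → q ℕ.≤ suc m
  primitive-order-≥ {ξ} (_ , log) {m} 0<m ξᵐ≈1 =
    Finₚ.injective⇒≤ {f = λ i → proj₁ (index (from i))} λ {i} {j} eq → from-injective (begin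
      from i                                    ≈⟨ proj₂ (index (from i)) ⟩
      zeroOrPower ξ (proj₁ (index (from i)))    ≡⟨ ≡.cong (zeroOrPower ξ) eq ⟩
      zeroOrPower ξ (proj₁ (index (from j)))    ≈⟨ proj₂ (index (from j)) ⟨
      from j                                    ∎)
    where
    instance
      m≢0 : NonZero m
      m≢0 = ℕ.>-nonZero 0<m
    index : ∀ x → ∃ λ (i : Fin (suc m)) → x ≈ zeroOrPower ξ i
    index x with x ≟ 0#
    ... | yes x≈0 = zero , x≈0
    ... | no  x≉0 with log x x≉0
    ...   | n , x≈ξⁿ = suc (fromℕ< (ℕ.m%n<n n m)) , (begin
      x                                  ≈⟨ x≈ξⁿ ⟩
      ξ ^ n                              ≈⟨ ^-% m ξᵐ≈1 n ⟩
      ξ ^ (n ℕ.% m)                      ≡⟨ ≡.cong (ξ ^_) (Finₚ.toℕ-fromℕ< (ℕ.m%n<n n m)) ⟨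
      ξ ^ toℕ (fromℕ< (ℕ.m%n<n n m))     ∎)

  -- Among 0 and the q powers from ξ^0 to ξ^(q-1) two must coincide. The difference of their
  -- exponents is at most q - 1, and by `primitive-order-≥` at least q - 1.
  primitive-^[q-1] : ∀ {ξ} → IsPrimitive ξ → ξ ^ (q ℕ.∸ 1) ≈ 1#
  primitive-^[q-1] {ξ} prim@(ξ≉0 , _)
    with Finₚ.pigeonhole (ℕ.n<1+n q) (to ∘ zeroOrPower ξ)
  -- A repetition involving 0 is impossible because powers of ξ are nonzero.
  ... | zero  , suc j , _   , eq = contradiction (sym (to-injective eq)) (^-≉0 (toℕ j) ξ≉0)
  ... | suc i , suc j , i<j , eq = begin
    ξ ^ (q ℕ.∸ 1)         ≡⟨ ≡.cong (ξ ^_) (ℕ.≤-antisym (ℕ.∸-monoˡ-≤ 1 q≤1+m) m≤q-1) ⟩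
    ξ ^ (toℕ j ℕ.∸ toℕ i) ≈⟨ ξᵐ≈1 ⟩
    1#                    ∎
    where
    i<j′ = ℕ.s<s⁻¹ i<j
    ξᵐ≈1 = ^-cancelˡ ξ≉0 (ℕ.<⇒≤ i<j′) (to-injective eq)
    q≤1+m = primitive-order-≥ prim (ℕ.m<n⇒0<n∸m i<j′) ξᵐ≈1
    m≤q-1 : toℕ j ℕ.∸ toℕ i ℕ.≤ q ℕ.∸ 1
    m≤q-1 = ℕ.≤-trans (ℕ.m∸n≤m (toℕ j) (toℕ i)) (ℕ.∸-monoˡ-≤ 1 (Finₚ.toℕ<n j))

  -- The d-th root of unity ω and the cyclotomic classes, told apart by s-th powers.

  module CyclotomicClasses {d s} (0<d : 0 ℕ.< d) (0<s : 0 ℕ.< s) (q-1≡ds : q ℕ.∸ 1 ≡ d ℕ.* s)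
                           {ξ} (prim : IsPrimitive ξ) where

    ω : Carrier
    ω = ξ ^ s

    ξ≉0 : ξ ≉ 0#
    ξ≉0 = proj₁ prim

    ω≉0 : ω ≉ 0#
    ω≉0 = ^-≉0 s ξ≉0

    ωᵈ≈1 : ω ^ d ≈ 1#
    ωᵈ≈1 = begin
      (ξ ^ s) ^ d      ≈⟨ ^-comm ξ s d ⟩
      (ξ ^ d) ^ s      ≈⟨ ^-assocʳ ξ d s ⟩
      ξ ^ (d ℕ.* s)    ≡⟨ ≡.cong (ξ ^_) q-1≡ds ⟨
      ξ ^ (q ℕ.∸ 1)    ≈⟨ primitive-^[q-1] prim ⟩
      1#               ∎

    -- Here ω^n is ξ^(sn), so the order bound for ξ reads 1 + sd ≤ 1 + sn, and s cancels.
    ω-exponent : ∀ n → ω ^ n ≈ 1# → 0 ℕ.< n → d ℕ.≤ n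
    ω-exponent n ωⁿ≈1 0<n = ℕ.*-cancelˡ-≤ s (ℕ.≤-pred (≡.subst (ℕ._≤ suc (s ℕ.* n)) q≡1+sd
        (primitive-order-≥ prim (ℕ.*-mono-≤ 0<s 0<n) (trans (sym (^-assocʳ ξ s n)) ωⁿ≈1))))
      where
      instance
        s≢0 : NonZero s
        s≢0 = ℕ.>-nonZero 0<s
      q≡1+sd : q ≡ suc (s ℕ.* d)
      q≡1+sd = ≡.trans (q∸1≡m⇒q≡1+m q-1≡ds) (≡.cong suc (ℕ.*-comm d s))

    ω-^-≢ : ∀ {i j} → i ℕ.< j → j ℕ.< d → ω ^ i ≉ ω ^ j
    ω-^-≢ {i} {j} i<j j<d ωⁱ≈ωʲ = ℕ.<⇒≱ (ℕ.≤-<-trans (ℕ.m∸n≤m j i) j<d)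
      (ω-exponent (j ℕ.∸ i) (^-cancelˡ ω≉0 (ℕ.<⇒≤ i<j) ωⁱ≈ωʲ) (ℕ.m<n⇒0<n∸m i<j))

    ω-^-injective : (i j : Fin d) → ω ^ toℕ i ≈ ω ^ toℕ j → i ≡ j
    ω-^-injective i j eq with ℕ.<-cmp (toℕ i) (toℕ j)
    ... | tri< i<j _ _ = contradiction eq (ω-^-≢ i<j (Finₚ.toℕ<n j))
    ... | tri≈ _ i≡j _ = Finₚ.toℕ-injective i≡j
    ... | tri> _ _ j<i = contradiction (sym eq) (ω-^-≢ j<i (Finₚ.toℕ<n i))

    -- If x = ξ^n then x^s = ω^n, where only n mod d matters. The index k names the coset of the
    -- powers of ξ^d that contains x.
    class : ∀ {x} → x ≉ 0# → ∃ λ (k : Fin d) → x ^ s ≈ ω ^ toℕ k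
    class {x} x≉0 with proj₂ prim x x≉0
    ... | n , x≈ξⁿ = fromℕ< n%d<d , (begin
      x ^ s                     ≈⟨ ^-congˡ s x≈ξⁿ ⟩
      (ξ ^ n) ^ s               ≈⟨ ^-comm ξ n s ⟩
      ω ^ n                     ≈⟨ ^-% d ωᵈ≈1 n ⟩
      ω ^ (n ℕ.% d)             ≡⟨ ≡.cong (ω ^_) (Finₚ.toℕ-fromℕ< n%d<d) ⟨
      ω ^ toℕ (fromℕ< n%d<d)    ∎)
      where
      instance
        d≢0 : NonZero d
        d≢0 = ℕ.>-nonZero 0<d
      n%d<d = ℕ.m%n<n n d

    -- The common ratio of the geometric sums over j: it is 1 exactly when x^s = ω^m.
    ratio : ℕ → Carrier → Carrier
    ratio m x = (ω ⁻¹) ^ m * x ^ s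

    -- By `class`, x^s is a power of ω, so both factors are d-th roots of unity.
    ratio-^d : ∀ m {x} → x ≉ 0# → ratio m x ^ d ≈ 1#
    ratio-^d m {x} x≉0 with class x≉0
    ... | k , xˢ≈ωᵏ = begin
      ((ω ⁻¹) ^ m * x ^ s) ^ d             ≈⟨ ^-distrib-* _ _ d ⟩
      ((ω ⁻¹) ^ m) ^ d * (x ^ s) ^ d       ≈⟨ *-cong (^-comm (ω ⁻¹) m d) (^-congˡ d xˢ≈ωᵏ) ⟩
      ((ω ⁻¹) ^ d) ^ m * (ω ^ toℕ k) ^ d   ≈⟨ *-cong (^-congˡ m ω⁻ᵈ≈1) (trans (^-comm ω (toℕ k) d) (^-congˡ (toℕ k) ωᵈ≈1)) ⟩
      1# ^ m * 1# ^ toℕ k                  ≈⟨ *-cong (1^n≈1 m) (1^n≈1 (toℕ k)) ⟩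
      1# * 1#                              ≈⟨ *-identityˡ _ ⟩
      1#                                   ∎
      where
      ω⁻ᵈ≈1 : (ω ⁻¹) ^ d ≈ 1#
      ω⁻ᵈ≈1 = trans (sym (*-identityʳ _)) (trans (*-congˡ (sym ωᵈ≈1)) (^-inverse d ω≉0))

    xˢ≈ωᵐ⇒ratio≈1 : ∀ m {x} → x ^ s ≈ ω ^ m → ratio m x ≈ 1#
    xˢ≈ωᵐ⇒ratio≈1 m eq = trans (*-congˡ eq) (^-inverse m ω≉0)

    ratio≈1⇒xˢ≈ωᵐ : ∀ m {x} → ratio m x ≈ 1# → x ^ s ≈ ω ^ m
    ratio≈1⇒xˢ≈ωᵐ m eq =
      *-cancelˡ-≉0 (^-≉0 m (⁻¹-≉0 ω≉0)) (trans eq (sym (^-inverse m ω≉0)))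

-- Evaluation of polynomials respects sums, products and powers.

module EvaluationProperties {c ℓ : Level} {q : ℕ} (F : FiniteField c ℓ q) where
  open FiniteField F hiding (zero)
  open Polynomials F
  open FieldProperties F

  open import Algebra.Properties.CommutativeSemigroup *-commutativeSemigroup
    using (x∙yz≈y∙xz)
  open import Algebra.Properties.CommutativeSemigroup +-commutativeSemigroup
    using (interchange)
  open import Algebra.Properties.CommutativeMonoid.Sum +-commutativeMonoid
    using (sum; sum-cong-≋)
  open import Algebra.Properties.Semiring.Exp semiring using (^-congˡ)
  open import Relation.Binary.Reasoning.Setoid setoid

  eval-cong : ∀ f {x y} → x ≈ y → eval f x ≈ eval f y
  eval-cong []      x≈y = refl
  eval-cong (a ∷ f) x≈y = +-congˡ (*-cong x≈y (eval-cong f x≈y))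

  eval-+ : ∀ f g x → eval (f +ᴾ g) x ≈ eval f x + eval g x
  eval-+ []      g       x = sym (+-identityˡ _)
  eval-+ (a ∷ f) []      x = sym (+-identityʳ _)
  eval-+ (a ∷ f) (b ∷ g) x = begin
    a + b + x * eval (f +ᴾ g) x             ≈⟨ +-congˡ (*-congˡ (eval-+ f g x)) ⟩
    a + b + x * (eval f x + eval g x)       ≈⟨ +-congˡ (distribˡ _ _ _) ⟩
    a + b + (x * eval f x + x * eval g x)   ≈⟨ interchange _ _ _ _ ⟩
    a + x * eval f x + (b + x * eval g x)   ∎

  eval-map-* : ∀ a f x → eval (map (a *_) f) x ≈ a * eval f x
  eval-map-* a []      x = sym (zeroʳ a)
  eval-map-* a (b ∷ f) x = begin
    a * b + x * eval (map (a *_) f) x  ≈⟨ +-congˡ (*-congˡ (eval-map-* a f x)) ⟩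
    a * b + x * (a * eval f x)         ≈⟨ +-congˡ (x∙yz≈y∙xz _ _ _) ⟩
    a * b + a * (x * eval f x)         ≈⟨ distribˡ _ _ _ ⟨
    a * (b + x * eval f x)             ∎

  eval-* : ∀ f g x → eval (f *ᴾ g) x ≈ eval f x * eval g x
  eval-* []      g x = sym (zeroˡ _)
  eval-* (a ∷ f) g x = begin
    eval (map (a *_) g +ᴾ (0# ∷ f *ᴾ g)) x             ≈⟨ eval-+ (map (a *_) g) (0# ∷ f *ᴾ g) x ⟩
    eval (map (a *_) g) x + (0# + x * eval (f *ᴾ g) x) ≈⟨ +-cong (eval-map-* a g x) (+-identityˡ _) ⟩
    a * eval g x + x * eval (f *ᴾ g) x                 ≈⟨ +-congˡ (*-congˡ (eval-* f g x)) ⟩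
    a * eval g x + x * (eval f x * eval g x)           ≈⟨ +-congˡ (*-assoc _ _ _) ⟨
    a * eval g x + x * eval f x * eval g x             ≈⟨ distribʳ _ _ _ ⟨
    (a + x * eval f x) * eval g x                      ∎

  eval-C : ∀ a x → eval (C a) x ≈ a
  eval-C a x = trans (+-congˡ (zeroʳ x)) (+-identityʳ a)

  eval-X : ∀ x → eval X x ≈ x
  eval-X x = trans (+-identityˡ _) (trans (*-congˡ (eval-C 1# x)) (*-identityʳ x))

  eval-C* : ∀ a f x → eval (C a *ᴾ f) x ≈ a * eval f x
  eval-C* a f x = trans (eval-* (C a) f x) (*-congʳ (eval-C a x))

  eval-^ : ∀ f n x → eval (f ^ᴾ n) x ≈ eval f x ^ n
  eval-^ f zero    x = eval-C 1# x
  eval-^ f (suc n) x = trans (eval-* f (f ^ᴾ n) x) (*-congˡ (eval-^ f n x))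

  eval-∑ : ∀ {n} (f : Fin n → Polynomial) x → eval (∑ᴾ f) x ≈ sum (λ i → eval (f i) x)
  eval-∑ {zero}  f x = refl
  eval-∑ {suc n} f x =
    trans (eval-+ (f zero) (∑ᴾ (f ∘ suc)) x) (+-congˡ (eval-∑ (f ∘ suc) x))

  eval-C*∑∑ : ∀ {m n} a (f : Fin m → Fin n → Polynomial) {e : Fin m → Fin n → Carrier} {x} →
              (∀ i j → eval (f i j) x ≈ e i j) →
              eval (C a *ᴾ ∑ᴾ (λ i → ∑ᴾ (f i))) x ≈ a * sum (λ i → sum (e i))
  eval-C*∑∑ a f {e} {x} eq = begin
    eval (C a *ᴾ ∑ᴾ (λ i → ∑ᴾ (f i))) x   ≈⟨ eval-C* a (∑ᴾ (λ i → ∑ᴾ (f i))) x ⟩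
    a * eval (∑ᴾ (λ i → ∑ᴾ (f i))) x      ≈⟨ *-congˡ (eval-∑ (λ i → ∑ᴾ (f i)) x) ⟩
    a * sum (λ i → eval (∑ᴾ (f i)) x)
      ≈⟨ *-congˡ (sum-cong-≋ λ i → trans (eval-∑ (f i) x) (sum-cong-≋ (eq i))) ⟩
    a * sum (λ i → sum (e i))             ∎

  -- This handles the argument 0, where the ratios are not roots of unity and `orthogonality` does
  -- not apply: there every term vanishes by itself.
  eval-C*∑∑≈0 : ∀ {m n} a (f : Fin m → Fin n → Polynomial) {x} →
                (∀ i j → eval (f i j) x ≈ 0#) →
                eval (C a *ᴾ ∑ᴾ (λ i → ∑ᴾ (f i))) x ≈ 0#
  eval-C*∑∑≈0 {m} {n} a f eq = trans (eval-C*∑∑ a f eq)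
    (trans (*-congˡ (sum-zero {m} (λ i → sum-zero {n} (λ j → refl)))) (zeroʳ a))

  eval-monomial : ∀ a b n x → eval (C a *ᴾ (C b *ᴾ X) ^ᴾ n) x ≈ a * (b * x) ^ n
  eval-monomial a b n x = begin
    eval (C a *ᴾ (C b *ᴾ X) ^ᴾ n) x   ≈⟨ eval-C* a ((C b *ᴾ X) ^ᴾ n) x ⟩
    a * eval ((C b *ᴾ X) ^ᴾ n) x      ≈⟨ *-congˡ (eval-^ (C b *ᴾ X) n x) ⟩
    a * eval (C b *ᴾ X) x ^ n         ≈⟨ *-congˡ (^-congˡ n (trans (eval-C* b X x) (*-congˡ (eval-X x)))) ⟩
    a * (b * x) ^ n                   ∎

-- Values of the cyclotomic mapping on each class.

module CyclotomicMapping {c ℓ : Level} {q : ℕ} (F : FiniteField c ℓ q) where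
  open FiniteField F hiding (zero)
  open Polynomials F
  open FieldProperties F
  open EvaluationProperties F

  open import Algebra.Properties.CommutativeSemigroup *-commutativeSemigroup
    using (interchange)
  open import Algebra.Properties.Semiring.Exp semiring
    using (^-congˡ; ^-homo-*; ^-assocʳ)
  open import Algebra.Properties.CommutativeSemiring.Exp commutativeSemiring
    using (^-distrib-*)
  open import Relation.Binary.Reasoning.Setoid setoid

  module _ {d s} (0<d : 0 ℕ.< d) (0<s : 0 ℕ.< s) (q-1≡ds : q ℕ.∸ 1 ≡ d ℕ.* s)
           {ξ} (prim : IsPrimitive ξ)
           (r : Fin d → ℕ) (0<r : ∀ i → 0 ℕ.< r i)
           (a : Fin d → Carrier) (a≉0 : ∀ i → a i ≉ 0#) where

    open CyclotomicClasses 0<d 0<s q-1≡ds prim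

    d≉0 : d ×ℕ 1# ≉ 0#
    d≉0 = d∣q-1⇒d×1≉0 {d} {s} q-1≡ds

    f-term : Fin d → Fin d → Polynomial
    f-term i j = C (a i * ω ^ᶻ (ℤ.- (+ (toℕ i ℕ.* toℕ j)))) *ᴾ X ^ᴾ (r i ℕ.+ toℕ j ℕ.* s)

    f : Polynomial
    f = C ((d ×ℕ 1#) ⁻¹) *ᴾ ∑ᴾ (λ i → ∑ᴾ (f-term i))

    -- All dependence on j is gathered into a power of one ratio. The parameters fit both
    -- polynomials: n is i for `f`, and i times `r i` for `g`.
    geometric-term : ∀ b m n (j : ℕ) x →
      (b * (ω ⁻¹) ^ (n ℕ.* j)) * x ^ (m ℕ.+ j ℕ.* s) ≈ (b * x ^ m) * ratio n x ^ j
    geometric-term b m n j x = begin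
      (b * (ω ⁻¹) ^ (n ℕ.* j)) * x ^ (m ℕ.+ j ℕ.* s)
        ≈⟨ *-congˡ (^-homo-* x m (j ℕ.* s)) ⟩
      (b * (ω ⁻¹) ^ (n ℕ.* j)) * (x ^ m * x ^ (j ℕ.* s))
        ≈⟨ interchange _ _ _ _ ⟩
      (b * x ^ m) * ((ω ⁻¹) ^ (n ℕ.* j) * x ^ (j ℕ.* s))
        ≈⟨ *-congˡ (*-cong (sym (^-assocʳ (ω ⁻¹) n j))
             (trans (sym (^-assocʳ x j s)) (^-comm x j s))) ⟩
      (b * x ^ m) * (((ω ⁻¹) ^ n) ^ j * (x ^ s) ^ j)
        ≈⟨ *-congˡ (^-distrib-* ((ω ⁻¹) ^ n) (x ^ s) j) ⟨
      (b * x ^ m) * ratio n x ^ j ∎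

    eval-f-term : ∀ i j x → eval (f-term i j) x ≈ (a i * x ^ r i) * ratio (toℕ i) x ^ toℕ j
    eval-f-term i j x = begin
      eval (f-term i j) x
        ≈⟨ eval-C* _ (X ^ᴾ (r i ℕ.+ toℕ j ℕ.* s)) x ⟩
      (a i * ω ^ᶻ (ℤ.- (+ (toℕ i ℕ.* toℕ j)))) * eval (X ^ᴾ (r i ℕ.+ toℕ j ℕ.* s)) x
        ≈⟨ *-cong (*-congˡ (^ᶻ-neg ω (toℕ i ℕ.* toℕ j)))
             (trans (eval-^ X (r i ℕ.+ toℕ j ℕ.* s) x) (^-congˡ (r i ℕ.+ toℕ j ℕ.* s) (eval-X x))) ⟩
      (a i * (ω ⁻¹) ^ (toℕ i ℕ.* toℕ j)) * x ^ (r i ℕ.+ toℕ j ℕ.* s)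
        ≈⟨ geometric-term (a i) (r i) (toℕ i) (toℕ j) x ⟩
      (a i * x ^ r i) * ratio (toℕ i) x ^ toℕ j ∎

    eval-f : ∀ {x} → x ≉ 0# → ∀ k → x ^ s ≈ ω ^ toℕ k → eval f x ≈ a k * x ^ r k
    eval-f {x} x≉0 k xˢ≈ωᵏ = trans
      (eval-C*∑∑ _ f-term (λ i j → eval-f-term i j x))
      (orthogonality d≉0 (λ i → a i * x ^ r i) (λ i → ratio (toℕ i) x) k
        (λ i → ratio-^d (toℕ i) x≉0)
        (xˢ≈ωᵐ⇒ratio≈1 (toℕ k) xˢ≈ωᵏ)
        -- A second index with ratio 1 would give ω^i = x^s = ω^k.
        (λ i i≢k u≈1 → i≢k (ω-^-injective i k
          (trans (sym (ratio≈1⇒xˢ≈ωᵐ (toℕ i) u≈1)) xˢ≈ωᵏ))))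

    eval-f-zero : ∀ {x} → x ≈ 0# → eval f x ≈ 0#
    eval-f-zero {x} x≈0 = eval-C*∑∑≈0 _ f-term λ i j → begin
      eval (f-term i j) x                         ≈⟨ eval-f-term i j x ⟩
      -- Positivity of `r i` matters, because `0# ^ 0` is `1#`.
      (a i * x ^ r i) * ratio (toℕ i) x ^ toℕ j   ≈⟨ *-congʳ (*-congˡ (^-zeroˡ (0<r i) x≈0)) ⟩
      (a i * 0#) * ratio (toℕ i) x ^ toℕ j        ≈⟨ *-congʳ (zeroʳ (a i)) ⟩
      0# * ratio (toℕ i) x ^ toℕ j                ≈⟨ zeroˡ _ ⟩
      0#                                          ∎

    -- The candidate inverse and its values on the image of `f`.

    module _ (r̃ : Fin d → ℕ) (t : Fin d → ℤ) (0<r̃ : ∀ i → 1 ℕ.≤ r̃ i)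
             (rr̃+st≡1 : ∀ i → (+ r i) ℤ.* (+ r̃ i) ℤ.+ (+ s) ℤ.* t i ≡ 1ℤ) where

      g-term : Fin d → Fin d → Polynomial
      g-term i j = C (ω ^ᶻ ((+ toℕ i) ℤ.* (t i ℤ.- (+ toℕ j) ℤ.* (+ r i))))
        *ᴾ (C (a i ⁻¹) *ᴾ X) ^ᴾ (r̃ i ℕ.+ toℕ j ℕ.* s)

      g : Polynomial
      g = C ((d ×ℕ 1#) ⁻¹) *ᴾ ∑ᴾ (λ i → ∑ᴾ (g-term i))

      -- The part of the i-th summand of `g` that is free of j. It is also the element that `bezout`
      -- builds from v = ω^i and w = y / a_i.
      preimage : Fin d → Carrier → Carrier
      preimage i y = (ω ^ toℕ i) ^ᶻ t i * (a i ⁻¹ * y) ^ r̃ i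

      -- The exponent splits into i t_i, which goes into `preimage`, and a negative multiple of j,
      -- which goes into the ratio.
      ω-exponent-split : ∀ i j →
        ω ^ᶻ ((+ toℕ i) ℤ.* (t i ℤ.- (+ j) ℤ.* (+ r i))) ≈
        (ω ^ toℕ i) ^ᶻ t i * (ω ⁻¹) ^ (toℕ i ℕ.* r i ℕ.* j)
      ω-exponent-split i j = begin
        ω ^ᶻ ((+ n) ℤ.* (t i ℤ.- (+ j) ℤ.* (+ r i)))
          ≈⟨ ^ᶻ-congʳ ω (rearrange (+ n) (t i) (+ j) (+ r i)) ⟩
        ω ^ᶻ ((+ n) ℤ.* t i ℤ.+ ℤ.- ((+ n) ℤ.* (+ r i) ℤ.* (+ j)))
          -- The integer product is rewritten as the image of a natural number, the form that
          -- `^ᶻ-neg` accepts.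
          ≈⟨ ^ᶻ-congʳ ω (≡.cong (λ m → (+ n) ℤ.* t i ℤ.+ ℤ.- m)
               (≡.trans (≡.cong (ℤ._* (+ j)) (≡.sym (ℤₚ.pos-* n (r i))))
                 (≡.sym (ℤₚ.pos-* (n ℕ.* r i) j)))) ⟩
        ω ^ᶻ ((+ n) ℤ.* t i ℤ.+ ℤ.- (+ (n ℕ.* r i ℕ.* j)))
          ≈⟨ ^ᶻ-homo-* ((+ n) ℤ.* t i) _ ω≉0 ⟩
        ω ^ᶻ ((+ n) ℤ.* t i) * ω ^ᶻ (ℤ.- (+ (n ℕ.* r i ℕ.* j)))
          ≈⟨ *-cong (trans (sym (^ᶻ-assocˡ ω n (t i))) (^ᶻ-^-comm n (t i) ω≉0))
               (^ᶻ-neg ω (n ℕ.* r i ℕ.* j)) ⟩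
        (ω ^ n) ^ᶻ t i * (ω ⁻¹) ^ (n ℕ.* r i ℕ.* j) ∎
        where
        n = toℕ i
        rearrange : ∀ n t j r → n ℤ.* (t ℤ.- j ℤ.* r) ≡ n ℤ.* t ℤ.+ ℤ.- (n ℤ.* r ℤ.* j)
        rearrange = solve-∀

      eval-g-term : ∀ i j y →
        eval (g-term i j) y ≈ preimage i y * ratio (toℕ i ℕ.* r i) (a i ⁻¹ * y) ^ toℕ j
      eval-g-term i j y = begin
        eval (g-term i j) y
          ≈⟨ eval-monomial _ (a i ⁻¹) (r̃ i ℕ.+ toℕ j ℕ.* s) y ⟩
        ω ^ᶻ ((+ toℕ i) ℤ.* (t i ℤ.- (+ toℕ j) ℤ.* (+ r i))) * (a i ⁻¹ * y) ^ (r̃ i ℕ.+ toℕ j ℕ.* s)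
          ≈⟨ *-congʳ (ω-exponent-split i (toℕ j)) ⟩
        ((ω ^ toℕ i) ^ᶻ t i * (ω ⁻¹) ^ (toℕ i ℕ.* r i ℕ.* toℕ j)) * (a i ⁻¹ * y) ^ (r̃ i ℕ.+ toℕ j ℕ.* s)
          ≈⟨ geometric-term _ (r̃ i) (toℕ i ℕ.* r i) (toℕ j) (a i ⁻¹ * y) ⟩
        preimage i y * ratio (toℕ i ℕ.* r i) (a i ⁻¹ * y) ^ toℕ j ∎

      eval-g-zero : ∀ {y} → y ≈ 0# → eval g y ≈ 0#
      eval-g-zero {y} y≈0 = eval-C*∑∑≈0 _ g-term λ i j →
        trans (eval-monomial _ (a i ⁻¹) (r̃ i ℕ.+ toℕ j ℕ.* s) y)
          (trans (*-congˡ (^-zeroˡ (ℕ.≤-trans (0<r̃ i) (ℕ.m≤m+n (r̃ i) (toℕ j ℕ.* s)))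
              (trans (*-congˡ y≈0) (zeroʳ _))))
            (zeroʳ _))

      -- The first half of `bezout` places the preimage in class i, so `eval-f` computes its image
      -- with the index i; the second half shows that this image is y.
      eval-f-preimage : ∀ i {y} → y ≉ 0# → (a i ⁻¹ * y) ^ s ≈ ω ^ (toℕ i ℕ.* r i) →
                        preimage i y ^ s ≈ ω ^ toℕ i × eval f (preimage i y) ≈ y
      eval-f-preimage i {y} y≉0 wˢ≈ωⁱʳ = zˢ≈ωⁱ , (begin
        eval f (preimage i y)        ≈⟨ eval-f z≉0 i zˢ≈ωⁱ ⟩
        a i * preimage i y ^ r i     ≈⟨ *-congˡ zʳ≈w ⟩
        a i * (a i ⁻¹ * y)           ≈⟨ *-assoc _ _ _ ⟨
        a i * a i ⁻¹ * y             ≈⟨ *-congʳ (trans (*-comm _ _) (⁻¹-inverseˡ (a≉0 i))) ⟩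
        1# * y                       ≈⟨ *-identityˡ y ⟩
        y                            ∎)
        where
        v≉0 = ^-≉0 (toℕ i) ω≉0
        w≉0 = *-≉0 (⁻¹-≉0 (a≉0 i)) y≉0
        z≉0 = *-≉0 (^ᶻ-≉0 (t i) v≉0) (^-≉0 (r̃ i) w≉0)
        powers = bezout (r i) s (r̃ i) (t i) (rr̃+st≡1 i) v≉0 w≉0
          (trans wˢ≈ωⁱʳ (sym (^-assocʳ ω (toℕ i) (r i))))
        zˢ≈ωⁱ = proj₁ powers
        zʳ≈w = proj₂ powers

      -- A summand survives only if its ratio is 1, which is the displayed condition on (y / a_i)^s;
      -- k is assumed to be the only such index.
      eval-g : ∀ {y} → y ≉ 0# → ∀ k → (a k ⁻¹ * y) ^ s ≈ ω ^ (toℕ k ℕ.* r k) →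
               (∀ i → (a i ⁻¹ * y) ^ s ≈ ω ^ (toℕ i ℕ.* r i) → i ≡ k) →
               eval g y ≈ preimage k y
      eval-g {y} y≉0 k wₖˢ≈ unique = trans
        (eval-C*∑∑ _ g-term (λ i j → eval-g-term i j y))
        (orthogonality d≉0 (λ i → preimage i y) (λ i → ratio (toℕ i ℕ.* r i) (a i ⁻¹ * y)) k
          (λ i → ratio-^d (toℕ i ℕ.* r i) (*-≉0 (⁻¹-≉0 (a≉0 i)) y≉0))
          (xˢ≈ωᵐ⇒ratio≈1 (toℕ k ℕ.* r k) wₖˢ≈)
          (λ i i≢k u≈1 → i≢k (unique i (ratio≈1⇒xˢ≈ωᵐ (toℕ i ℕ.* r i) u≈1))))

      -- The class k of x meets the survival condition, and injectivity of `f` identifies the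
      -- preimage attached to any surviving index with x itself.
      eval-g-image : (∀ x z → eval f x ≈ eval f z → x ≈ z) →
                     ∀ {x} → x ≉ 0# → ∀ k → x ^ s ≈ ω ^ toℕ k →
                     ∀ {y} → eval f x ≈ y → eval g y ≈ x
      eval-g-image f-injective {x} x≉0 k xˢ≈ωᵏ {y} fx≈y =
        trans (eval-g y≉0 k wₖˢ≈ unique) (preimage≈x k wₖˢ≈)
        where
        y≈axʳ : y ≈ a k * x ^ r k
        y≈axʳ = trans (sym fx≈y) (eval-f x≉0 k xˢ≈ωᵏ)

        y≉0 : y ≉ 0#
        y≉0 = ≉-resp-≈ (sym y≈axʳ) (*-≉0 (a≉0 k) (^-≉0 (r k) x≉0))

        wₖ≈xʳ : a k ⁻¹ * y ≈ x ^ r k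
        wₖ≈xʳ = begin
          a k ⁻¹ * y                ≈⟨ *-congˡ y≈axʳ ⟩
          a k ⁻¹ * (a k * x ^ r k)  ≈⟨ *-assoc _ _ _ ⟨
          a k ⁻¹ * a k * x ^ r k    ≈⟨ *-congʳ (⁻¹-inverseˡ (a≉0 k)) ⟩
          1# * x ^ r k              ≈⟨ *-identityˡ _ ⟩
          x ^ r k                   ∎

        wₖˢ≈ : (a k ⁻¹ * y) ^ s ≈ ω ^ (toℕ k ℕ.* r k)
        wₖˢ≈ = begin
          (a k ⁻¹ * y) ^ s       ≈⟨ ^-congˡ s wₖ≈xʳ ⟩
          (x ^ r k) ^ s          ≈⟨ ^-comm x (r k) s ⟩
          (x ^ s) ^ r k          ≈⟨ ^-congˡ (r k) xˢ≈ωᵏ ⟩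
          (ω ^ toℕ k) ^ r k      ≈⟨ ^-assocʳ ω (toℕ k) (r k) ⟩
          ω ^ (toℕ k ℕ.* r k)    ∎

        preimage≈x : ∀ i → (a i ⁻¹ * y) ^ s ≈ ω ^ (toℕ i ℕ.* r i) → preimage i y ≈ x
        preimage≈x i wˢ≈ = f-injective (preimage i y) x
          (trans (proj₂ (eval-f-preimage i y≉0 wˢ≈)) (sym fx≈y))

        unique : ∀ i → (a i ⁻¹ * y) ^ s ≈ ω ^ (toℕ i ℕ.* r i) → i ≡ k
        -- The preimage lies in class i and equals x, which lies in class k.
        unique i wˢ≈ = ω-^-injective i k (begin
          ω ^ toℕ i          ≈⟨ proj₁ (eval-f-preimage i y≉0 wˢ≈) ⟨
          preimage i y ^ s   ≈⟨ ^-congˡ s (preimage≈x i wˢ≈) ⟩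
          x ^ s              ≈⟨ xˢ≈ωᵏ ⟩
          ω ^ toℕ k          ∎)

      g-inverse-f : (∀ x z → eval f x ≈ eval f z → x ≈ z) → g IsInverseOf f
      g-inverse-f f-injective x with x ≟ 0#
      -- 0 belongs to no cyclotomic class, but `f` and `g` both fix it.
      ... | yes x≈0 = trans (eval-g-zero (eval-f-zero x≈0)) (sym x≈0)
      ... | no  x≉0 =
        eval-g-image f-injective x≉0 (proj₁ (class x≉0)) (proj₂ (class x≉0)) refl

theorem3p3 :
  ∀ {c ℓ : Level} (q : ℕ) → IsPrimePower q → (F : FiniteField c ℓ q) →
  let open FiniteField F
      open Polynomials F
  in
  (d s : ℕ) → 0 ℕ.< d → 0 ℕ.< s → q ℕ.∸ 1 ≡ d ℕ.* s →
  (r : Fin d → ℕ) → (∀ i → 0 ℕ.< r i) →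
  (a : Fin d → Carrier) → (∀ i → ¬ (a i ≈ 0#)) →
  (ξ : Carrier) → IsPrimitive ξ →
  let ω = ξ ^ s
      1/d = (d ×ℕ 1#) ⁻¹
      f = C 1/d *ᴾ ∑ᴾ (λ (i : Fin d) → ∑ᴾ (λ (j : Fin d) →
            C (a i * ω ^ᶻ (ℤ.- (+ (toℕ i ℕ.* toℕ j)))) *ᴾ X ^ᴾ (r i ℕ.+ toℕ j ℕ.* s)))
  in
  IsPermutationPolynomial f →
  (r̃ : Fin d → ℕ) (t : Fin d → ℤ) →
  (∀ i → 1 ℕ.≤ r̃ i) → (∀ i → r̃ i ℕ.< s) →
  (∀ i → (+ r i) ℤ.* (+ r̃ i) ℤ.+ (+ s) ℤ.* t i ≡ 1ℤ) →
  let g = C 1/d *ᴾ ∑ᴾ (λ (i : Fin d) → ∑ᴾ (λ (j : Fin d) →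
            C (ω ^ᶻ ((+ toℕ i) ℤ.* (t i ℤ.- (+ toℕ j) ℤ.* (+ r i))))
              *ᴾ (C (a i ⁻¹) *ᴾ X) ^ᴾ (r̃ i ℕ.+ toℕ j ℕ.* s)))
  in
  g IsInverseOf f
theorem3p3 q _ F d s 0<d 0<s q-1≡ds r 0<r a a≉0 ξ prim f-bijective r̃ t 0<r̃ _ rr̃+st≡1 =
  CyclotomicMapping.g-inverse-f F 0<d 0<s q-1≡ds prim r 0<r a a≉0 r̃ t 0<r̃ rr̃+st≡1
    (λ _ _ → proj₁ f-bijective)
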